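{- $\Sigma\Pi f\equiv_{\mathrm{sW}}(\Pi f)^{\mathcal D}$ for every problem $f$, where $\Pi f$ is the parallelization of $f$, $\Sigma$ denotes stashing, and $g^{\mathcal D}$ denotes the upper Turing cone version of a problem $g$.
   Context: A represented space is a set $X$ with a partial surjective map $\delta_X:\subseteq\mathbb N^{\mathbb N}\to X$. A problem is a partial multi-valued function $f:\subseteq X\rightrightarrows Y$ between represented spaces that has a realizer; a realizer of $f$ is a function $F:\subseteq\mathbb N^{\mathbb N}\to\mathbb N^{\mathbb N}$ with $\delta_YF(p)\in f\delta_X(p)$ for all $p\in\mathrm{dom}(f\delta_X)$. For problems $f,g$: $f\leq_{\mathrm{sW}}g$ if there are computable $H,K:\subseteq\mathbb N^{\mathbb N}\to\mathbb N^{\mathbb N}$ such that $HGK$ is a realizer of $f$ whenever $G$ is a realizer of $g$; $f\equiv_{\mathrm{sW}}g$ means $f\leq_{\mathrm{sW}}g$ and $g\leq_{\mathrm{sW}}f$. For a represented space $Y$, the completion $\overline Y:=Y\cup\{\bot\}$ ($\bot\notin Y$) is represented by the total map $\delta_{\overline Y}$ with $\delta_{\overline Y}(p)=\delta_Y(p-1)$ if $p-1\in\mathrm{dom}(\delta_Y)$ and $\delta_{\overline Y}(p)=\bot$ otherwise, where $p-1\in\mathbb N^{\mathbb N}\cup\mathbb N^*$ is the concatenation of $p(0)-1,p(1)-1,\dots$ and $0-1$ is the empty word. $X^{\mathbb N}$ is represented by $\langle p_0,p_1,\dots\rangle\mapsto(\delta_X(p_n))_n$, where $\langle p_0,p_1,\dots\rangle\langle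 n,k\rangle:=p_n(k)$ and $\langle n,k\rangle:=\frac12(n+k)(n+k+1)+k$ for $n,k\in\mathbb N$. For $f:\subseteq X\rightrightarrows Y$: the parallelization $\Pi f:\subseteq X^{\mathbb N}\rightrightarrows Y^{\mathbb N}$ (also written $\widehat f$) has domain $\mathrm{dom}(f)^{\mathbb N}$ and $\Pi f((x_n)_n)=\{(y_n)_n:(\forall n)\ y_n\in f(x_n)\}$; the stashing $\Sigma f:\subseteq X^{\mathbb N}\rightrightarrows\overline Y^{\mathbb N}$ has domain $\mathrm{dom}(f)^{\mathbb N}$ and $\Sigma f((x_n)_n)=\{(y_n)_n\in\overline Y^{\mathbb N}:(\exists n)\ y_n\in f(x_n)\}$. $\mathcal D$ is the set of Turing degrees $\deg_{\mathrm T}(p)=\{q\in\mathbb N^{\mathbb N}:q\equiv_{\mathrm T}p\}$, represented by $\delta_{\mathcal D}(p)=\deg_{\mathrm T}(p)$. For $y$ in a represented space $(Y,\delta_Y)$ and $q\in\mathbb N^{\mathbb N}$, $y\leq_{\mathrm T}q$ means that some name $p\in\delta_Y^{ -1}\{y\}$ satisfies $p\leq_{\mathrm T}q$. The upper Turing cone version of $f:\subseteq X\rightrightarrows Y$ is $f^{\mathcal D}:\subseteq X\rightrightarrows\mathcal D$ with $\mathrm{dom}(f^{\mathcal D})=\mathrm{dom}(f)$ and $f^{\mathcal D}(x)=\{\deg_{\mathrm T}(q):(\exists y\leq_{\mathrm T}q)\ y\in f(x)\}$. -}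

module Defs where

open import Axiom.ExcludedMiddle using (ExcludedMiddle)
open import Data.Empty using (⊥-elim)
open import Data.List.Base using (List; []; _∷_; _++_; [_]; length; concatMap; applyUpTo)
open import Data.List.Properties using (length-applyUpTo; ∷-injective)
open import Data.Maybe.Base using (Maybe; just; nothing)
import Data.Maybe.Relation.Binary.Pointwise as Maybe
open import Data.Nat.Base using (ℕ; zero; suc; _+_; _*_; _<_; _≤_; z≤n; s≤s; z<s; s<s)
open import Data.Nat.Properties using (+-suc; +-identityʳ; suc-injective; ≤-total; n<1+n)
open import Data.Nat.Divisibility using (divides-refl)
open import Data.Nat.DivMod using (_/_; +-distrib-/-∣ʳ; m*n/n≡m)
open import Data.Nat.Tactic.RingSolver using (solve-∀)
open import Data.Product.Base using (∃; ∃-syntax; _×_; _,_; proj₁; proj₂)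
open import Data.Sum.Base using (inj₁; inj₂)
open import Function.Bundles using (_⇔_; mk⇔)
open import Level using (0ℓ)
open import Relation.Binary.Bundles using (Setoid)
open import Relation.Binary.PropositionalEquality
  using (_≡_; _≗_; refl; sym; trans; cong; cong₂; subst; _→-setoid_; module ≡-Reasoning)
open import Relation.Nullary.Decidable.Core using (yes; no)
open import Relation.Nullary.Negation.Core using (¬_)

open Setoid using (Carrier)

BaireSpace : Setoid 0ℓ 0ℓ
BaireSpace = ℕ →-setoid ℕ

Baire : Set
Baire = ℕ → ℕ

⟨_,_⟩ : ℕ → ℕ → ℕ
⟨ n , k ⟩ = ((n + k) * (n + k + 1)) / 2 + k

-- The inverse of ⟨_,_⟩, obtained by walking along the antidiagonals.
next : ℕ × ℕ → ℕ × ℕ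
next (zero  , k) = suc k , 0
next (suc n , k) = n , suc k

unpair : ℕ → ℕ × ℕ
unpair zero    = 0 , 0
unpair (suc m) = next (unpair m)

pair-suc : ∀ n k → ⟨ n , suc k ⟩ ≡ suc ⟨ suc n , k ⟩
pair-suc n k rewrite +-suc n k = +-suc _ k

half-step : ∀ k → (suc k * (suc k + 1)) / 2 ≡ suc ((k * (k + 1)) / 2 + k)
half-step k = begin
  (suc k * (suc k + 1)) / 2              ≡⟨ cong (_/ 2) (expand k) ⟩
  (k * (k + 1) + suc k * 2) / 2          ≡⟨ +-distrib-/-∣ʳ (k * (k + 1)) (divides-refl (suc k)) ⟩
  (k * (k + 1)) / 2 + (suc k * 2) / 2    ≡⟨ cong ((k * (k + 1)) / 2 +_) (m*n/n≡m (suc k) 2) ⟩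
  (k * (k + 1)) / 2 + suc k              ≡⟨ +-suc _ k ⟩
  suc ((k * (k + 1)) / 2 + k)            ∎
  where
  open ≡-Reasoning
  expand : ∀ k → suc k * (suc k + 1) ≡ k * (k + 1) + suc k * 2
  expand = solve-∀

pair-wrap : ∀ k → ⟨ suc k , 0 ⟩ ≡ suc ⟨ 0 , k ⟩
pair-wrap k rewrite +-identityʳ k = trans (+-identityʳ _) (half-step k)

pair-unpair : ∀ m → ⟨ proj₁ (unpair m) , proj₂ (unpair m) ⟩ ≡ m
pair-unpair zero    = refl
pair-unpair (suc m) with unpair m | pair-unpair m
... | zero  , k | eq = trans (pair-wrap k) (cong suc eq)
... | suc n , k | eq = trans (pair-suc n k) (cong suc eq)

unpair-at : ∀ m n k → ⟨ n , k ⟩ ≡ m → unpair m ≡ (n , k)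
unpair-at zero    zero    zero    eq = refl
unpair-at zero    (suc n) zero    eq with trans (sym (pair-wrap n)) eq
... | ()
unpair-at zero    n       (suc k) eq with trans (sym (pair-suc n k)) eq
... | ()
unpair-at (suc m) zero    zero    ()
unpair-at (suc m) (suc n) zero    eq =
  cong next (unpair-at m 0 n (suc-injective (trans (sym (pair-wrap n)) eq)))
unpair-at (suc m) n       (suc k) eq =
  cong next (unpair-at m (suc n) k (suc-injective (trans (sym (pair-suc n k)) eq)))

unpair-pair : ∀ n k → unpair ⟨ n , k ⟩ ≡ (n , k)
unpair-pair n k = unpair-at ⟨ n , k ⟩ n k refl

component : Baire → ℕ → Baire
component p n k = p ⟨ n , k ⟩

tuple : (ℕ → Baire) → Baire
tuple ps m = ps (proj₁ (unpair m)) (proj₂ (unpair m))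

component-tuple : ∀ ps n → component (tuple ps) n ≗ ps n
component-tuple ps n k rewrite unpair-pair n k = refl

component-injective : ∀ {p q} → (∀ n → component p n ≗ component q n) → p ≗ q
component-injective {p} {q} eq m =
  subst (λ i → p i ≡ q i) (pair-unpair m) (eq (proj₁ (unpair m)) (proj₂ (unpair m)))

-- Kleene's schemes for unary functions, with several arguments passed
-- through ⟨_,_⟩.
data Code : Set where
  zeroᶜ succᶜ leftᶜ rightᶜ oracleᶜ : Code
  pairᶜ compᶜ precᶜ : Code → Code → Code
  rfindᶜ : Code → Code

PrimRec : (f g : ℕ → ℕ → Set) (a k : ℕ) → ℕ → Set
PrimRec f g a zero    m = f a m
PrimRec f g a (suc k) m = ∃[ r ] PrimRec f g a k r × g ⟨ a , ⟨ k , r ⟩ ⟩ m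

-- ⟦ e ⟧ p n m : the e-th partial function with oracle p is defined at n
-- with value m.
⟦_⟧ : Code → Baire → ℕ → ℕ → Set
⟦ zeroᶜ     ⟧ p n m = m ≡ 0
⟦ succᶜ     ⟧ p n m = m ≡ suc n
⟦ leftᶜ     ⟧ p n m = ∃[ b ] n ≡ ⟨ m , b ⟩
⟦ rightᶜ    ⟧ p n m = ∃[ a ] n ≡ ⟨ a , m ⟩
⟦ oracleᶜ   ⟧ p n m = m ≡ p n
⟦ pairᶜ e d ⟧ p n m = ∃[ a ] ∃[ b ] ⟦ e ⟧ p n a × ⟦ d ⟧ p n b × m ≡ ⟨ a , b ⟩
⟦ compᶜ e d ⟧ p n m = ∃[ k ] ⟦ d ⟧ p n k × ⟦ e ⟧ p k m
⟦ precᶜ e d ⟧ p n m = ∃[ a ] ∃[ k ] n ≡ ⟨ a , k ⟩ × PrimRec (⟦ e ⟧ p) (⟦ d ⟧ p) a k m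
⟦ rfindᶜ e  ⟧ p n m = ⟦ e ⟧ p ⟨ n , m ⟩ 0 × (∀ i → i < m → ∃[ j ] ⟦ e ⟧ p ⟨ n , i ⟩ (suc j))

infix 4 _≤T_ _≡T_

_≤T_ : Baire → Baire → Set
q ≤T p = ∃[ e ] ∀ k → ⟦ e ⟧ p k (q k)

_≡T_ : Baire → Baire → Set
p ≡T q = p ≤T q × q ≤T p

≤T-reflexive : ∀ {p q} → p ≗ q → p ≤T q
≤T-reflexive eq = oracleᶜ , eq

relativize : Code → Code → Code
relativize d zeroᶜ        = zeroᶜ
relativize d succᶜ        = succᶜ
relativize d leftᶜ        = leftᶜ
relativize d rightᶜ       = rightᶜ
relativize d oracleᶜ      = d
relativize d (pairᶜ e e′) = pairᶜ (relativize d e) (relativize d e′)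
relativize d (compᶜ e e′) = compᶜ (relativize d e) (relativize d e′)
relativize d (precᶜ e e′) = precᶜ (relativize d e) (relativize d e′)
relativize d (rfindᶜ e)   = rfindᶜ (relativize d e)

PrimRec-mono : ∀ {f f′ g g′ : ℕ → ℕ → Set} →
               (∀ n m → f n m → f′ n m) → (∀ n m → g n m → g′ n m) →
               ∀ a k m → PrimRec f g a k m → PrimRec f′ g′ a k m
PrimRec-mono F G a zero    m h           = F _ _ h
PrimRec-mono F G a (suc k) m (r , h , s) = r , PrimRec-mono F G a k r h , G _ _ s

relativize-sound : ∀ {p q d} → (∀ k → ⟦ d ⟧ p k (q k)) →
                   ∀ e n m → ⟦ e ⟧ q n m → ⟦ relativize d e ⟧ p n m
relativize-sound h zeroᶜ        n m x = x
relativize-sound h succᶜ        n m x = x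
relativize-sound h leftᶜ        n m x = x
relativize-sound h rightᶜ       n m x = x
relativize-sound h oracleᶜ      n _ refl = h n
relativize-sound h (pairᶜ e e′) n m (a , b , x , y , eq) =
  a , b , relativize-sound h e n a x , relativize-sound h e′ n b y , eq
relativize-sound h (compᶜ e e′) n m (k , x , y) =
  k , relativize-sound h e′ n k x , relativize-sound h e k m y
relativize-sound h (precᶜ e e′) n m (a , k , eq , x) =
  a , k , eq , PrimRec-mono (relativize-sound h e) (relativize-sound h e′) a k m x
relativize-sound h (rfindᶜ e)   n m (x , y) =
  relativize-sound h e _ _ x ,
  λ i i<m → proj₁ (y i i<m) , relativize-sound h e _ _ (proj₂ (y i i<m))

≤T-trans : ∀ {p q r} → p ≤T q → q ≤T r → p ≤T r
≤T-trans (e , x) (d , y) = relativize d e , λ k → relativize-sound y e _ _ (x k)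

-- The set 𝒟 of Turing degrees as the quotient of Baire space by ≡T:
-- p, taken as an element of this setoid, stands for deg_T(p).
TuringDegree : Setoid 0ℓ 0ℓ
TuringDegree = record
  { Carrier = Baire
  ; _≈_     = _≡T_
  ; isEquivalence = record
    { refl  = ≤T-reflexive (λ _ → refl) , ≤T-reflexive (λ _ → refl)
    ; sym   = λ (x , y) → y , x
    ; trans = λ (x , y) (x′ , y′) → ≤T-trans x x′ , ≤T-trans y′ y
    }
  }

infixr 9 _∘ₚ_
infix  2 _⇀_

-- Partial functions as single-valued relations; they may be arbitrary,
-- in particular non-computable and with undecidable domain.
record _⇀_ (A B : Setoid 0ℓ 0ℓ) : Set₁ where
  private
    module A = Setoid A
    module B = Setoid B
  field
    graph        : A.Carrier → B.Carrier → Set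
    respects     : ∀ {a a′ b b′} → a A.≈ a′ → b B.≈ b′ → graph a b → graph a′ b′
    singleValued : ∀ {a b b′} → graph a b → graph a b′ → b B.≈ b′

open _⇀_ public using (graph; respects; singleValued)

_∘ₚ_ : ∀ {A B C} → B ⇀ C → A ⇀ B → A ⇀ C
_∘ₚ_ {A} {B} {C} g f = record
  { graph        = λ a c → ∃[ b ] graph f a b × graph g b c
  ; respects     = λ a≈ c≈ (b , x , y) →
      b , respects f a≈ (Setoid.refl B) x , respects g (Setoid.refl B) c≈ y
  ; singleValued = λ (b , x , y) (b′ , x′ , y′) →
      singleValued g (respects g (singleValued f x x′) (Setoid.refl C) y) y′
  }

-- As usual in computable analysis, nothing is required outside the
-- domain of F.
Computable : BaireSpace ⇀ BaireSpace → Set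
Computable F = ∃[ e ] ∀ p q → graph F p q → ∀ k → ⟦ e ⟧ p k (q k)

record RepresentedSpace : Set₁ where
  field
    points     : Setoid 0ℓ 0ℓ
    δ          : BaireSpace ⇀ points
    surjective : ∀ x → ∃[ p ] graph δ p x

  Point : Set
  Point = Carrier points

  open Setoid points public using (_≈_)

open RepresentedSpace public using (points; δ; surjective; Point)

𝒟 : RepresentedSpace
𝒟 = record
  { points = TuringDegree
  ; δ = record
    { graph        = λ p d → p ≡T d
    ; respects     = λ p≗ d≡ x →
        T.trans (≤T-reflexive (λ k → sym (p≗ k)) , ≤T-reflexive p≗) (T.trans x d≡)
    ; singleValued = λ x y → T.trans (T.sym x) y
    }
  ; surjective = λ d → d , T.refl
  }
  where module T = Setoid TuringDegree

PointSequence : Setoid 0ℓ 0ℓ → Setoid 0ℓ 0ℓ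
PointSequence X = record
  { Carrier = ℕ → X.Carrier
  ; _≈_     = λ x y → ∀ n → x n X.≈ y n
  ; isEquivalence = record
    { refl  = λ n → X.refl
    ; sym   = λ x n → X.sym (x n)
    ; trans = λ x y n → X.trans (x n) (y n)
    }
  }
  where module X = Setoid X

infix 10 _^ℕ

_^ℕ : RepresentedSpace → RepresentedSpace
X ^ℕ = record
  { points = PointSequence (points X)
  ; δ = record
    { graph        = λ p x → ∀ n → graph (δ X) (component p n) (x n)
    ; respects     = λ p≗ x≈ h n → respects (δ X) (λ k → p≗ ⟨ n , k ⟩) (x≈ n) (h n)
    ; singleValued = λ h h′ n → singleValued (δ X) (h n) (h′ n)
    }
  ; surjective = λ x →
      tuple (λ n → proj₁ (surjective X (x n))) ,
      λ n → respects (δ X)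
              (λ k → sym (component-tuple (λ i → proj₁ (surjective X (x i))) n k))
              (Setoid.refl (points X))
              (proj₂ (surjective X (x n)))
  }

-- The letter n - 1 as a word, where 0 - 1 is the empty word.
letter-1 : ℕ → List ℕ
letter-1 zero    = []
letter-1 (suc n) = [ n ]

word-1 : Baire → ℕ → List ℕ
word-1 p n = concatMap letter-1 (applyUpTo p n)

infix 4 _-1≐_

-- p -1≐ q : the concatenation p - 1 is infinite and equals q.  The words
-- word-1 p n grow by at most one letter at a time, so this holds exactly
-- if every finite prefix of q is one of them.
_-1≐_ : Baire → Baire → Set
p -1≐ q = ∀ k → ∃[ n ] word-1 p n ≡ applyUpTo q k

applyUpTo-cong : ∀ {p q : Baire} → p ≗ q → ∀ n → applyUpTo p n ≡ applyUpTo q n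
applyUpTo-cong eq zero    = refl
applyUpTo-cong eq (suc n) = cong₂ _∷_ (eq 0) (applyUpTo-cong (λ i → eq (suc i)) n)

applyUpTo-injective : ∀ {p q : Baire} n → applyUpTo p n ≡ applyUpTo q n →
                      ∀ i → i < n → p i ≡ q i
applyUpTo-injective (suc n) eq zero    z<s       = proj₁ (∷-injective eq)
applyUpTo-injective (suc n) eq (suc i) (s<s i<n) =
  applyUpTo-injective n (proj₂ (∷-injective eq)) i i<n

prefix-≤ : ∀ (p : Baire) {m n} → m ≤ n → ∃[ v ] word-1 p n ≡ word-1 p m ++ v
prefix-≤ p {n = n} z≤n = word-1 p n , refl
prefix-≤ p (s≤s m≤n) with p 0 | prefix-≤ (λ i → p (suc i)) m≤n
... | zero  | v , eq = v , eq
... | suc a | v , eq = v , cong (a ∷_) eq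

++-same-length : ∀ (u : List ℕ) {w v} → w ≡ u ++ v → length w ≡ length u → w ≡ u
++-same-length []      {[]}    eq l = refl
++-same-length (x ∷ u) {y ∷ w} eq l =
  cong₂ _∷_ (proj₁ (∷-injective eq))
            (++-same-length u (proj₂ (∷-injective eq)) (suc-injective l))

same-length : ∀ p m n → length (word-1 p m) ≡ length (word-1 p n) → word-1 p m ≡ word-1 p n
same-length p m n l with ≤-total m n
... | inj₁ m≤n = sym (++-same-length (word-1 p m) (proj₂ (prefix-≤ p m≤n)) (sym l))
... | inj₂ n≤m = ++-same-length (word-1 p n) (proj₂ (prefix-≤ p n≤m)) l

-1≐-respects : ∀ {p p′ q q′} → p ≗ p′ → q ≗ q′ → p -1≐ q → p′ -1≐ q′
-1≐-respects p≗ q≗ h k with h k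
... | n , eq = n , trans (cong (concatMap letter-1) (sym (applyUpTo-cong p≗ n)))
                         (trans eq (applyUpTo-cong q≗ k))

-1≐-singleValued : ∀ {p q q′} → p -1≐ q → p -1≐ q′ → q ≗ q′
-1≐-singleValued {p} {q} {q′} h h′ k with h (suc k) | h′ (suc k)
... | n , eq | n′ , eq′ =
  applyUpTo-injective {q} {q′} (suc k)
    (trans (sym eq) (trans (same-length p n n′ lengths) eq′)) k (n<1+n k)
  where
  lengths : length (word-1 p n) ≡ length (word-1 p n′)
  lengths = trans (cong length eq)
           (trans (length-applyUpTo q (suc k))
           (sym (trans (cong length eq′) (length-applyUpTo q′ (suc k)))))

-1≐-suc : ∀ q → (λ k → suc (q k)) -1≐ q
-1≐-suc q k = k , go q k
  where
  go : ∀ q k → word-1 (λ i → suc (q i)) k ≡ applyUpTo q k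
  go q zero    = refl
  go q (suc k) = cong (q 0 ∷_) (go (λ i → q (suc i)) k)

word-1-zeros : ∀ n → word-1 (λ _ → 0) n ≡ []
word-1-zeros zero    = refl
word-1-zeros (suc n) = word-1-zeros n

zeros-finite : ∀ {q} → ¬ ((λ _ → 0) -1≐ q)
zeros-finite h with h 1
... | n , eq with trans (sym (word-1-zeros n)) eq
... | ()

-- ⊥ is encoded as nothing.
completionGraph : ∀ (Y : RepresentedSpace) → Baire → Maybe (Point Y) → Set
completionGraph Y p (just y) = ∃[ q ] p -1≐ q × graph (δ Y) q y
completionGraph Y p nothing  = ¬ (∃[ y ] completionGraph Y p (just y))

completion : RepresentedSpace → RepresentedSpace
completion Y = record
  { points = Maybe.setoid (points Y)
  ; δ = record
    { graph        = completionGraph Y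
    ; respects     = resp
    ; singleValued = single
    }
  ; surjective = onto
  }
  where
  module Y = Setoid (points Y)

  resp-just : ∀ {p p′ y y′} → p ≗ p′ → y Y.≈ y′ →
              completionGraph Y p (just y) → completionGraph Y p′ (just y′)
  resp-just p≗ y≈ (q , h , x) =
    q , -1≐-respects p≗ (λ _ → refl) h , respects (δ Y) (λ _ → refl) y≈ x

  resp : ∀ {p p′ y y′} → p ≗ p′ → Maybe.Pointwise Y._≈_ y y′ →
         completionGraph Y p y → completionGraph Y p′ y′
  resp p≗ (Maybe.just y≈) x = resp-just p≗ y≈ x
  resp p≗ Maybe.nothing   x =
    λ (y , h) → x (y , resp-just (λ k → sym (p≗ k)) Y.refl h)

  single : ∀ {p y y′} → completionGraph Y p y → completionGraph Y p y′ →
           Maybe.Pointwise Y._≈_ y y′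
  single {y = just _}  {just _}  (q , h , x) (q′ , h′ , x′) =
    Maybe.just (singleValued (δ Y)
      (respects (δ Y) (-1≐-singleValued h h′) Y.refl x) x′)
  single {y = just y}  {nothing} x x′ = ⊥-elim (x′ (y , x))
  single {y = nothing} {just y}  x x′ = ⊥-elim (x (y , x′))
  single {y = nothing} {nothing} x x′ = Maybe.nothing

  onto : ∀ y → ∃[ p ] completionGraph Y p y
  onto (just y) with surjective Y y
  ... | q , x = (λ k → suc (q k)) , q , -1≐-suc q , x
  onto nothing  = (λ _ → 0) , λ (y , q , h , x) → zeros-finite h

-- Totality of the representation of the completion is a classical fact.
completion-total : ExcludedMiddle 0ℓ → ∀ Y p → ∃[ y ] graph (δ (completion Y)) p y
completion-total em Y p with em {∃[ y ] completionGraph Y p (just y)}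
... | yes (y , x) = just y , x
... | no  none    = nothing , none

-- maps f x y means y ∈ f(x).
record MultiMap (X Y : RepresentedSpace) : Set₁ where
  private
    module X = RepresentedSpace X
    module Y = RepresentedSpace Y
  field
    maps     : Point X → Point Y → Set
    respects : ∀ {x x′ y y′} → x X.≈ x′ → y Y.≈ y′ → maps x y → maps x′ y′

  dom : Point X → Set
  dom x = ∃[ y ] maps x y

open MultiMap public using (maps; dom)

-- p lies in dom(f δ_X) iff δ_X(p) = x for some x ∈ dom(f).
_Realizes_ : ∀ {X Y} → BaireSpace ⇀ BaireSpace → MultiMap X Y → Set
_Realizes_ {X} {Y} F f =
  ∀ p x → graph (δ X) p x → dom f x →
  ∃[ q ] ∃[ y ] graph F p q × graph (δ Y) q y × maps f x y

record Problem (X Y : RepresentedSpace) : Set₁ where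
  field
    multiMap   : MultiMap X Y
    realizable : ∃[ F ] F Realizes multiMap

open Problem public using (multiMap; realizable)

infix 4 _≤sW_ _≡sW_

_≤sW_ : ∀ {X Y Z W} → Problem X Y → Problem Z W → Set₁
f ≤sW g =
  ∃[ H ] ∃[ K ] Computable H × Computable K ×
    (∀ G → G Realizes multiMap g → (H ∘ₚ G ∘ₚ K) Realizes multiMap f)

_≡sW_ : ∀ {X Y Z W} → Problem X Y → Problem Z W → Set₁
f ≡sW g = f ≤sW g × g ≤sW f

parallelizationMap : ∀ {X Y} → MultiMap X Y → MultiMap (X ^ℕ) (Y ^ℕ)
parallelizationMap f = record
  { maps     = λ x y → ∀ n → maps f (x n) (y n)
  ; respects = λ x≈ y≈ h n → MultiMap.respects f (x≈ n) (y≈ n) (h n)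
  }

dom-parallelization : ∀ {X Y} (f : MultiMap X Y) x →
                      dom (parallelizationMap f) x ⇔ (∀ n → dom f (x n))
dom-parallelization f x = mk⇔
  (λ (y , h) n → y n , h n)
  (λ d → (λ n → proj₁ (d n)) , λ n → proj₂ (d n))

Π : ∀ {X Y} → Problem X Y → Problem (X ^ℕ) (Y ^ℕ)
Π {X} {Y} f = record
  { multiMap   = parallelizationMap (multiMap f)
  ; realizable = F̂ , realizes
  }
  where
  F = proj₁ (realizable f)

  F̂ : BaireSpace ⇀ BaireSpace
  F̂ = record
    { graph        = λ p q → ∀ n → graph F (component p n) (component q n)
    ; respects     = λ p≗ q≗ h n →
        respects F (λ k → p≗ ⟨ n , k ⟩) (λ k → q≗ ⟨ n , k ⟩) (h n)
    ; singleValued = λ h h′ → component-injective (λ n → singleValued F (h n) (h′ n))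
    }

  realizes : F̂ Realizes parallelizationMap (multiMap f)
  realizes p x px (y , h) =
    tuple (λ n → proj₁ (r n)) , (λ n → proj₁ (proj₂ (r n))) ,
    (λ n → respects F (λ _ → refl) (eq n) (proj₁ (proj₂ (proj₂ (r n))))) ,
    (λ n → respects (δ Y) (eq n) (Setoid.refl (points Y))
             (proj₁ (proj₂ (proj₂ (proj₂ (r n)))))) ,
    (λ n → proj₂ (proj₂ (proj₂ (proj₂ (r n)))))
    where
    r = λ n → proj₂ (realizable f) (component p n) (x n) (px n) (y n , h n)
    eq : ∀ n → proj₁ (r n) ≗ component (tuple (λ i → proj₁ (r i))) n
    eq n k = sym (component-tuple (λ i → proj₁ (r i)) n k)

stashingMap : ∀ {X Y} → MultiMap X Y → MultiMap (X ^ℕ) (completion Y ^ℕ)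
stashingMap {X} {Y} f = record
  { maps     = λ x ȳ → (∀ n → dom f (x n)) ×
                       ∃[ n ] ∃[ y ] (ȳ n ≈ just y) × maps f (x n) y
  ; respects = λ x≈ ȳ≈ (d , n , y , eq , h) →
      (λ i → proj₁ (d i) ,
             MultiMap.respects f (x≈ i) (Setoid.refl (points Y)) (proj₂ (d i))) ,
      n , y , Ȳ.trans (Ȳ.sym (ȳ≈ n)) eq ,
      MultiMap.respects f (x≈ n) (Setoid.refl (points Y)) h
  }
  where
  open RepresentedSpace (completion Y) using (_≈_)
  module Ȳ = Setoid (points (completion Y))

dom-stashing : ∀ {X Y} (f : MultiMap X Y) x →
               dom (stashingMap f) x ⇔ (∀ n → dom f (x n))
dom-stashing {X} {Y} f x = mk⇔
  (λ (ȳ , d , _) → d)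
  (λ d → (λ n → just (proj₁ (d n))) , d , 0 , proj₁ (d 0) ,
         Setoid.refl (points (completion Y)) , proj₂ (d 0))

Σ : ∀ {X Y} → Problem X Y → Problem (X ^ℕ) (completion Y ^ℕ)
Σ {X} {Y} f = record
  { multiMap   = stashingMap (multiMap f)
  ; realizable = S , realizes
  }
  where
  F = proj₁ (realizable f)

  S : BaireSpace ⇀ BaireSpace
  S = record
    { graph        = λ p q → ∀ n →
        ∃[ r ] graph F (component p n) r × (∀ k → component q n k ≡ suc (r k))
    ; respects     = λ p≗ q≗ h n →
        proj₁ (h n) ,
        respects F (λ k → p≗ ⟨ n , k ⟩) (λ _ → refl) (proj₁ (proj₂ (h n))) ,
        λ k → trans (sym (q≗ ⟨ n , k ⟩)) (proj₂ (proj₂ (h n)) k)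
    ; singleValued = λ h h′ → component-injective (λ n k →
        trans (proj₂ (proj₂ (h n)) k)
       (trans (cong suc (singleValued F (proj₁ (proj₂ (h n))) (proj₁ (proj₂ (h′ n))) k))
       (sym (proj₂ (proj₂ (h′ n)) k))))
    }

  realizes : S Realizes stashingMap (multiMap f)
  realizes p x px (_ , d , _) =
    tuple s , (λ n → just (y n)) ,
    (λ n → q n , proj₁ (proj₂ (proj₂ (r n))) , component-tuple s n) ,
    (λ n → q n ,
       -1≐-respects (λ k → sym (component-tuple s n k)) (λ _ → refl) (-1≐-suc (q n)) ,
       proj₁ (proj₂ (proj₂ (proj₂ (r n))))) ,
    d , 0 , y 0 , Setoid.refl (points (completion Y)) ,
    proj₂ (proj₂ (proj₂ (proj₂ (r 0))))
    where
    r = λ n → proj₂ (realizable f) (component p n) (x n) (px n) (d n)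
    q = λ n → proj₁ (r n)
    y = λ n → proj₁ (proj₂ (r n))
    s = λ n k → suc (q n k)

PointBelow : (Y : RepresentedSpace) → Point Y → Baire → Set
PointBelow Y y q = ∃[ p ] graph (δ Y) p y × p ≤T q

syntax PointBelow Y y q = y ≤T[ Y ] q

coneMap : ∀ {X Y} → MultiMap X Y → MultiMap X 𝒟
coneMap {X} {Y} f = record
  { maps     = λ x d → ∃[ q ] (q ≡T d) × ∃[ y ] (y ≤T[ Y ] q) × maps f x y
  ; respects = λ x≈ d≡ (q , q≡ , y , y≤ , h) →
      q , Setoid.trans TuringDegree q≡ d≡ , y , y≤ ,
      MultiMap.respects f x≈ (Setoid.refl (points Y)) h
  }

dom-cone : ∀ {X Y} (f : MultiMap X Y) x → dom (coneMap f) x ⇔ dom f x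
dom-cone {X} {Y} f x = mk⇔
  (λ (_ , _ , _ , y , _ , h) → y , h)
  (λ (y , h) → let p , py = surjective Y y in
     p , p , Setoid.refl TuringDegree , y , (p , py , ≤T-reflexive (λ _ → refl)) , h)

infix 10 _ᴰ

_ᴰ : ∀ {X Y} → Problem X Y → Problem X 𝒟
f ᴰ = record
  { multiMap   = coneMap (multiMap f)
  ; realizable = proj₁ (realizable f) , λ p x px (_ , _ , _ , y , _ , h) →
      let q , y′ , Fpq , qy′ , h′ = proj₂ (realizable f) p x px (y , h) in
      q , q , Fpq , Setoid.refl TuringDegree ,
      q , Setoid.refl TuringDegree , y′ , (q , qy′ , ≤T-reflexive (λ _ → refl)) , h′
  }

{-# OPTIONS --safe #-}
module Submission where

-- For Σ Π f ≤ (Π f)ᴰ, merge the given sequences into a single instance of Π f.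
-- Any representative g of a degree above a solution computes a name of that
-- solution by some code e.  An interpreter with oracle g runs every code c and
-- writes the c-th row of what c computes as the c-th component, outputting 0
-- while it waits; the component with the index of e is correct, and the others
-- name something because the representation of a completion is total.
--
-- Conversely, feed Σ Π f with the constant sequence of the given instance.  An
-- output has a component that names a solution y; dropping the zeros from that
-- component needs only the index of the component as advice, so the degree of
-- the whole output lies above y.

open import Defs
open import Axiom.ExcludedMiddle using (ExcludedMiddle)
open import Data.List.Base using (_∷_; _++_; applyUpTo)
open import Data.List.Properties using (∷-injective)
open import Data.Nat.Base using (ℕ; zero; suc; _+_; _<_; _≤‴_; ≤‴-refl; ≤‴-step; z≤n; s≤s)
open import Data.Nat.GeneralisedArithmetic using (fold; iterate; iterate-is-fold)
open import Data.Nat.Properties using (+-suc; +-identityʳ; ≤⇒≤‴; ≤‴⇒≤)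
open import Data.Product.Base using (∃-syntax; _×_; _,_; proj₁; proj₂)
open import Function.Bundles using (module Equivalence)
open import Level using (0ℓ)
open import Relation.Binary.Bundles using (Setoid)
open import Relation.Binary.PropositionalEquality
  using (_≡_; _≗_; refl; sym; trans; cong; cong₂; subst)

-- Primitive recursive terms with an oracle

infixr 9 _∙_
infixr 5 _▹_

data Term : Set where
  constᵗ                           : ℕ → Term
  succᵗ leftᵗ rightᵗ atomᵗ oracleᵗ : Term
  pairᵗ _∙_ _▹_ iterᵗ              : Term → Term → Term

module Semantics {V : Set} (atom : ℕ → V) (val : V → ℕ)
                 (pair : V → V → V) (left right : V → V) where

  -- A positive selector is passed on decreased by one, so a right-nested chain of `▹` dispatches on
  -- a tag.
  branch : (V → V) → (V → V) → ℕ → V → V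
  branch f g zero    x = f x
  branch f g (suc k) x = g (pair (atom k) x)

  eval : Baire → Term → V → V
  eval p (constᵗ k)  x = atom k
  eval p succᵗ       x = atom (suc (val x))
  eval p leftᵗ       x = left x
  eval p rightᵗ      x = right x
  -- The identity over `ℕ`; over trees it collapses a value to a leaf.
  eval p atomᵗ       x = atom (val x)
  eval p oracleᵗ     x = atom (p (val x))
  eval p (pairᵗ t u) x = pair (eval p t x) (eval p u x)
  eval p (t ∙ u)     x = eval p t (eval p u x)
  eval p (t ▹ u)     x = branch (eval p t) (eval p u) (val (left x)) (right x)
  eval p (iterᵗ t u) x = iterate (eval p u) (eval p t (left x)) (val (right x))

-- Over trees a term computes definitionally on structured arguments, which
-- over ℕ is blocked by unpair ⟨ a , b ⟩.
data Tree : Set where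
  leaf : ℕ → Tree
  node : Tree → Tree → Tree

encode : Tree → ℕ
encode (leaf n)   = n
encode (node s t) = ⟨ encode s , encode t ⟩

leftTree rightTree : Tree → Tree
leftTree  (leaf n)   = leaf (proj₁ (unpair n))
leftTree  (node s t) = s
rightTree (leaf n)   = leaf (proj₂ (unpair n))
rightTree (node s t) = t

open Semantics {ℕ} (λ n → n) (λ n → n) ⟨_,_⟩ (λ n → proj₁ (unpair n)) (λ n → proj₂ (unpair n))
open Semantics leaf encode node leftTree rightTree
  using () renaming (eval to evalTree; branch to branchTree)

encode-left : ∀ x → encode (leftTree x) ≡ proj₁ (unpair (encode x))
encode-left (leaf n)   = refl
encode-left (node s t) = sym (cong proj₁ (unpair-pair (encode s) (encode t)))

encode-right : ∀ x → encode (rightTree x) ≡ proj₂ (unpair (encode x))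
encode-right (leaf n)   = refl
encode-right (node s t) = sym (cong proj₂ (unpair-pair (encode s) (encode t)))

-- `encode` commutes with every operation that the semantics is built from; this carries
-- computations on trees over to numbers.
encode-eval : ∀ p t x → encode (evalTree p t x) ≡ eval p t (encode x)
encode-eval p (constᵗ k)  x = refl
encode-eval p succᵗ       x = refl
encode-eval p leftᵗ       x = encode-left x
encode-eval p rightᵗ      x = encode-right x
encode-eval p atomᵗ       x = refl
encode-eval p oracleᵗ     x = refl
encode-eval p (pairᵗ t u) x = cong₂ ⟨_,_⟩ (encode-eval p t x) (encode-eval p u x)
encode-eval p (t ∙ u)     x =
  trans (encode-eval p t (evalTree p u x)) (cong (eval p t) (encode-eval p u x))
encode-eval p (t ▹ u)     x =
  trans (go (encode (leftTree x)))
        (cong₂ (branch (eval p t) (eval p u)) (encode-left x) (encode-right x))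
  where
  go : ∀ k → encode (branchTree (evalTree p t) (evalTree p u) k (rightTree x))
           ≡ branch (eval p t) (eval p u) k (encode (rightTree x))
  go zero    = encode-eval p t _
  go (suc k) = encode-eval p u _
encode-eval p (iterᵗ t u) x =
  trans (go (encode (rightTree x)) (evalTree p t (leftTree x)))
        (cong₂ (iterate (eval p u))
          (trans (encode-eval p t (leftTree x)) (cong (eval p t) (encode-left x)))
          (encode-right x))
  where
  go : ∀ k y → encode (iterate (evalTree p u) y k) ≡ iterate (eval p u) (encode y) k
  go zero    y = refl
  go (suc k) y = trans (go k (evalTree p u y))
                       (cong (λ z → iterate (eval p u) z k) (encode-eval p u y))

eval-cong : ∀ {p q} → p ≗ q → ∀ t x → eval p t x ≡ eval q t x
eval-cong p≗q (constᵗ k)  x = refl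
eval-cong p≗q succᵗ       x = refl
eval-cong p≗q leftᵗ       x = refl
eval-cong p≗q rightᵗ      x = refl
eval-cong p≗q atomᵗ       x = refl
eval-cong p≗q oracleᵗ     x = p≗q x
eval-cong p≗q (pairᵗ t u) x = cong₂ ⟨_,_⟩ (eval-cong p≗q t x) (eval-cong p≗q u x)
eval-cong {p} {q} p≗q (t ∙ u) x =
  trans (eval-cong p≗q t (eval p u x)) (cong (eval q t) (eval-cong p≗q u x))
eval-cong p≗q (t ▹ u)     x with proj₁ (unpair x)
... | zero  = eval-cong p≗q t _
... | suc k = eval-cong p≗q u _
eval-cong {p} {q} p≗q (iterᵗ t u) x =
  trans (go (proj₂ (unpair x)) _)
        (cong (λ z → iterate (eval q u) z (proj₂ (unpair x))) (eval-cong p≗q t _))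
  where
  go : ∀ k y → iterate (eval p u) y k ≡ iterate (eval q u) y k
  go zero    y = refl
  go (suc k) y = trans (go k (eval p u y))
                       (cong (λ z → iterate (eval q u) z k) (eval-cong p≗q u y))

-- Compilation of terms into codes

constᶜ : ℕ → Code
constᶜ zero    = zeroᶜ
constᶜ (suc k) = compᶜ succᶜ (constᶜ k)

constᶜ-sound : ∀ {p} k n → ⟦ constᶜ k ⟧ p n k
constᶜ-sound zero    n = refl
constᶜ-sound (suc k) n = k , constᶜ-sound k n , refl

leftᶜ-sound : ∀ {p} n → ⟦ leftᶜ ⟧ p n (proj₁ (unpair n))
leftᶜ-sound n = proj₂ (unpair n) , sym (pair-unpair n)

rightᶜ-sound : ∀ {p} n → ⟦ rightᶜ ⟧ p n (proj₂ (unpair n))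
rightᶜ-sound n = proj₁ (unpair n) , sym (pair-unpair n)

idᶜ : Code
idᶜ = pairᶜ leftᶜ rightᶜ

idᶜ-sound : ∀ {p} n → ⟦ idᶜ ⟧ p n n
idᶜ-sound {p} n =
  proj₁ (unpair n) , proj₂ (unpair n) , leftᶜ-sound {p} n , rightᶜ-sound {p} n , sym (pair-unpair n)

compile : Term → Code
compile (constᵗ k)  = constᶜ k
compile succᵗ       = succᶜ
compile leftᵗ       = leftᶜ
compile rightᵗ      = rightᶜ
compile atomᵗ       = idᶜ
compile oracleᵗ     = oracleᶜ
compile (pairᵗ t u) = pairᶜ (compile t) (compile u)
compile (t ∙ u)     = compᶜ (compile t) (compile u)
-- Case distinction is a primitive recursion that drops the recursive value; the swap puts the
-- selector second, where `precᶜ` recurses.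
compile (t ▹ u)     =
  compᶜ (precᶜ (compile t) (compᶜ (compile u) (pairᶜ (compᶜ leftᶜ rightᶜ) leftᶜ)))
        (pairᶜ rightᶜ leftᶜ)
compile (iterᵗ t u) = precᶜ (compile t) (compᶜ (compile u) (compᶜ rightᶜ rightᶜ))

compile-sound : ∀ p t n → ⟦ compile t ⟧ p n (eval p t n)
compile-sound p (constᵗ k)  n = constᶜ-sound k n
compile-sound p succᵗ       n = refl
compile-sound p leftᵗ       n = leftᶜ-sound {p} n
compile-sound p rightᵗ      n = rightᶜ-sound {p} n
compile-sound p atomᵗ       n = idᶜ-sound {p} n
compile-sound p oracleᵗ     n = refl
compile-sound p (pairᵗ t u) n = _ , _ , compile-sound p t n , compile-sound p u n , refl
compile-sound p (t ∙ u)     n = _ , compile-sound p u n , compile-sound p t _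
compile-sound p (t ▹ u)     n =
  ⟨ j , i ⟩ , (j , i , rightᶜ-sound {p} n , leftᶜ-sound {p} n , refl) ,
  j , i , refl , go i j
  where
  i = proj₁ (unpair n)
  j = proj₂ (unpair n)
  go : ∀ k x → PrimRec (⟦ compile t ⟧ p)
                       (⟦ compᶜ (compile u) (pairᶜ (compᶜ leftᶜ rightᶜ) leftᶜ) ⟧ p) x k
                       (branch (eval p t) (eval p u) k x)
  go zero    x = compile-sound p t x
  go (suc k) x =
    r , go k x ,
    ⟨ k , x ⟩ ,
    (k , x , (⟨ k , r ⟩ , (x , refl) , r , refl) , (⟨ k , r ⟩ , refl) , refl) ,
    compile-sound p u ⟨ k , x ⟩
    where r = branch (eval p t) (eval p u) k x
compile-sound p (iterᵗ t u) n =
  x , j , sym (pair-unpair n) ,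
  -- `PrimRec` adds each step on the outside, like `fold`, whereas `iterate` starts from the inside.
  subst (PrimRec (⟦ compile t ⟧ p) (⟦ compᶜ (compile u) (compᶜ rightᶜ rightᶜ) ⟧ p) x j)
        (iterate-is-fold (eval p t x) (eval p u) j)
        (go j)
  where
  x = proj₁ (unpair n)
  j = proj₂ (unpair n)
  go : ∀ k → PrimRec (⟦ compile t ⟧ p) (⟦ compᶜ (compile u) (compᶜ rightᶜ rightᶜ) ⟧ p) x k
                     (fold (eval p t x) (eval p u) k)
  go zero    = compile-sound p t x
  go (suc k) =
    r , go k , r , (⟨ k , r ⟩ , (x , refl) , k , refl) , compile-sound p u r
    where r = fold (eval p t x) (eval p u) k

operator : Term → BaireSpace ⇀ BaireSpace
operator t = record
  { graph        = λ p q → ∀ n → q n ≡ eval p t n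
  ; respects     = λ p≗ q≗ h n → trans (sym (q≗ n)) (trans (h n) (eval-cong p≗ t n))
  ; singleValued = λ h h′ n → trans (h n) (sym (h′ n))
  }

operator-computable : ∀ t → Computable (operator t)
operator-computable t = compile t , λ p q h n →
  subst (⟦ compile t ⟧ p n) (sym (h n)) (compile-sound p t n)

-- The universal machine

-- An interpreter for Code, as a stack machine with states ⟨ v , stack ⟩: the
-- topmost instruction is popped and consumes the value v.  An instruction is a
-- tag paired with its arguments.
instruction : ℕ → Tree → Tree
instruction tag args = node (leaf tag) args

program : Code → Tree
program zeroᶜ        = instruction 1 (leaf 0)
program succᶜ        = instruction 2 (leaf 0)
program leftᶜ        = instruction 3 (leaf 0)
program rightᶜ       = instruction 4 (leaf 0)
program oracleᶜ      = instruction 5 (leaf 0)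
program (pairᶜ e d)  = instruction 6 (node (program e) (program d))
program (compᶜ e d)  = instruction 7 (node (program e) (program d))
program (precᶜ e d)  = instruction 8 (node (program e) (program d))
program (rfindᶜ e)   = instruction 9 (program e)

-- The remaining instructions are continuations: 0 outputs a letter of a row and
-- starts on the next one, 10 and 11 hold the pending component of a pair, 12
-- awaits the previous value of a primitive recursion, and 13 and 14 alternate
-- in an unbounded search.
recurse : Tree → ℕ → ℕ → Tree
recurse d a k = instruction 12 (node d (node (leaf a) (leaf k)))

try : Tree → Tree → Tree
try e n = instruction 13 (node e n)

argsᵗ valueᵗ stackᵗ : Term
argsᵗ  = leftᵗ
valueᵗ = leftᵗ ∙ rightᵗ
stackᵗ = rightᵗ ∙ rightᵗ

instructionᵗ : ℕ → Term → Term
instructionᵗ tag t = pairᵗ (constᵗ tag) t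

-- Turns `⟨ v , ⟨ ⟨ tag , args ⟩ , κ ⟩ ⟩` into `⟨ tag , ⟨ args , ⟨ v , κ ⟩ ⟩ ⟩`; the dispatch
-- consumes the tag, and `argsᵗ`, `valueᵗ`, `stackᵗ` read the rest.
popᵗ : Term
popᵗ = pairᵗ (leftᵗ ∙ leftᵗ ∙ rightᵗ)
             (pairᵗ (rightᵗ ∙ leftᵗ ∙ rightᵗ) (pairᵗ leftᵗ (rightᵗ ∙ rightᵗ)))

-- Component c of the output lists the values of the code c at the arguments
-- ⟨⟨ c , l ⟩ , r ⟩, in the order of i = ⟨ l , r ⟩.
launchᵗ : Term
launchᵗ = pairᵗ (atomᵗ ∙ pairᵗ (pairᵗ leftᵗ (leftᵗ ∙ rightᵗ)) (rightᵗ ∙ rightᵗ))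
                (pairᵗ leftᵗ (pairᵗ (instructionᵗ 0 (pairᵗ leftᵗ rightᵗ)) (constᵗ 0)))

stepᵗ : Term
stepᵗ = (emitᵗ ▹ zeroᵗ ▹ sucᵗ ▹ lftᵗ ▹ rgtᵗ ▹ orclᵗ ▹ prᵗ ▹ cmpᵗ ▹ precᵗ ▹ rfindᵗ ▹
         pairFstᵗ ▹ pairSndᵗ ▹ recurseᵗ ▹ tryᵗ ▹ checkᵗ ▹ constᵗ 0) ∙ popᵗ
  where
  apply : Term → Term
  apply t = pairᵗ (t ∙ valueᵗ) stackᵗ
  emitᵗ     = launchᵗ ∙ pairᵗ (leftᵗ ∙ argsᵗ) (succᵗ ∙ rightᵗ ∙ argsᵗ)
  zeroᵗ     = apply (constᵗ 0)
  sucᵗ      = apply succᵗ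
  lftᵗ      = apply leftᵗ
  rgtᵗ      = apply rightᵗ
  orclᵗ     = apply oracleᵗ
  prᵗ       = pairᵗ valueᵗ (pairᵗ (leftᵗ ∙ argsᵗ)
                (pairᵗ (instructionᵗ 10 (pairᵗ (rightᵗ ∙ argsᵗ) valueᵗ)) stackᵗ))
  cmpᵗ      = pairᵗ valueᵗ (pairᵗ (rightᵗ ∙ argsᵗ) (pairᵗ (leftᵗ ∙ argsᵗ) stackᵗ))
  -- At a positive counter the recursion first runs at the predecessor; instruction 12 then applies
  -- the step program.
  precᵗ     = (pairᵗ (leftᵗ ∙ valueᵗ) (pairᵗ (leftᵗ ∙ argsᵗ) stackᵗ)
               ▹ pairᵗ (atomᵗ ∙ pairᵗ (leftᵗ ∙ valueᵗ ∙ rightᵗ) leftᵗ)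
                   (pairᵗ (instructionᵗ 8 (argsᵗ ∙ rightᵗ))
                   (pairᵗ (instructionᵗ 12 (pairᵗ (rightᵗ ∙ argsᵗ ∙ rightᵗ)
                             (pairᵗ (leftᵗ ∙ valueᵗ ∙ rightᵗ) leftᵗ)))
                          (stackᵗ ∙ rightᵗ))))
              ∙ pairᵗ (rightᵗ ∙ valueᵗ) (pairᵗ argsᵗ (pairᵗ valueᵗ stackᵗ))
  rfindᵗ    = pairᵗ (constᵗ 0) (pairᵗ (instructionᵗ 13 (pairᵗ argsᵗ valueᵗ)) stackᵗ)
  pairFstᵗ  = pairᵗ (rightᵗ ∙ argsᵗ)
                (pairᵗ (leftᵗ ∙ argsᵗ) (pairᵗ (instructionᵗ 11 valueᵗ) stackᵗ))
  pairSndᵗ  = pairᵗ (atomᵗ ∙ pairᵗ argsᵗ valueᵗ) stackᵗ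
  recurseᵗ  = pairᵗ (atomᵗ ∙ pairᵗ (leftᵗ ∙ rightᵗ ∙ argsᵗ)
                                   (pairᵗ (rightᵗ ∙ rightᵗ ∙ argsᵗ) valueᵗ))
                (pairᵗ (leftᵗ ∙ argsᵗ) stackᵗ)
  tryᵗ      = pairᵗ (atomᵗ ∙ pairᵗ (rightᵗ ∙ argsᵗ) valueᵗ)
                (pairᵗ (leftᵗ ∙ argsᵗ)
                (pairᵗ (instructionᵗ 14 (pairᵗ (pairᵗ (leftᵗ ∙ argsᵗ) (rightᵗ ∙ argsᵗ)) valueᵗ))
                       stackᵗ))
  checkᵗ    = (pairᵗ (rightᵗ ∙ argsᵗ) stackᵗ
               ▹ pairᵗ (succᵗ ∙ rightᵗ ∙ argsᵗ ∙ rightᵗ)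
                   (pairᵗ (instructionᵗ 13 (leftᵗ ∙ argsᵗ ∙ rightᵗ)) (stackᵗ ∙ rightᵗ)))
              ∙ pairᵗ valueᵗ (pairᵗ argsᵗ (pairᵗ valueᵗ stackᵗ))

-- Only tag 0 yields a letter, raised by one because the completion reads 0 as no letter.
outputᵗ : Term
outputᵗ = (succᵗ ∙ valueᵗ ▹ constᵗ 0) ∙ popᵗ

orbitᵗ : Term → Term → Term → Term
orbitᵗ o t u = o ∙ iterᵗ t u ∙ pairᵗ (pairᵗ leftᵗ (constᵗ 0)) rightᵗ

encode-orbit : ∀ p o t u c j →
  encode (evalTree p o (iterate (evalTree p u) (evalTree p t (node c (leaf 0))) j)) ≡
  eval p (orbitᵗ o t u) ⟨ encode c , j ⟩
encode-orbit p o t u c j = encode-eval p (orbitᵗ o t u) (node c (leaf j))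

universalᵗ : Term
universalᵗ = orbitᵗ outputᵗ launchᵗ stepᵗ

-- Silent runs and output words

module Transitions {S : Set} (step : S → S) (output : S → ℕ) where

  outputs : S → Baire
  outputs s j = output (iterate step s j)

  infixr 5 _◅_
  infix  4 _⟶_

  -- Every step of such a run outputs 0 and so leaves the listed word unchanged; the number of steps
  -- need not be tracked.
  data _⟶_ : S → S → Set where
    done   : ∀ {s} → s ⟶ s
    silent : ∀ {s s′ s″} → output s ≡ 0 → step s ≡ s′ → s′ ⟶ s″ → s ⟶ s″

  _◅_ : ∀ {s s′ s″} → s ⟶ s′ → s′ ⟶ s″ → s ⟶ s″
  done           ◅ r = r
  silent o eq r′ ◅ r = silent o eq (r′ ◅ r)

  word-silent : ∀ {s s′ w} → s ⟶ s′ → ∃[ n ] word-1 (outputs s′) n ≡ w →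
                ∃[ n ] word-1 (outputs s) n ≡ w
  word-silent done              h = h
  word-silent (silent o refl r) h with word-silent r h
  ... | n , eq = suc n , cong₂ (λ a v → letter-1 a ++ v) o eq

  word-emit : ∀ {s s′ a w} → output s ≡ suc a → step s ≡ s′ →
              ∃[ n ] word-1 (outputs s′) n ≡ w → ∃[ n ] word-1 (outputs s) n ≡ a ∷ w
  word-emit o refl (n , eq) = suc n , cong₂ (λ a v → letter-1 a ++ v) o eq

-- Correctness of the interpreter

module Machine (p : Baire) where

  step : Tree → Tree
  step = evalTree p stepᵗ

  output : Tree → ℕ
  output s = encode (evalTree p outputᵗ s)

  open Transitions step output

  pattern tick r = silent refl refl r

  -- Rewriting unblocks the case distinction on the counter; the branch taken projects from
  -- `unpair n` again, hence the second use of `eq`.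
  step-prec-zero : ∀ {n a} e d κ → unpair n ≡ (a , 0) →
    step (node (leaf n) (node (program (precᶜ e d)) κ)) ≡ node (leaf a) (node (program e) κ)
  step-prec-zero e d κ eq rewrite eq =
    cong (λ x → node (leaf x) (node (program e) κ)) (cong proj₁ eq)

  step-prec-suc : ∀ {n a k} e d κ → unpair n ≡ (a , suc k) →
    step (node (leaf n) (node (program (precᶜ e d)) κ)) ≡
    node (leaf ⟨ a , k ⟩) (node (program (precᶜ e d)) (node (recurse (program d) a k) κ))
  step-prec-suc {k = k} e d κ eq rewrite eq =
    cong (λ x → node (leaf ⟨ x , k ⟩)
                  (node (program (precᶜ e d)) (node (recurse (program d) x k) κ)))
         (cong proj₁ eq)

  -- The stack is arbitrary, so runs of subprograms can be chained by `_◅_`. The induction follows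
  -- the code and, within it, the recursion counter or the search.
  interpret : ∀ e {n m} κ → ⟦ e ⟧ p n m →
    node (leaf n) (node (program e) κ) ⟶ node (leaf m) κ

  interpret-prec : ∀ e d a k {m} κ → PrimRec (⟦ e ⟧ p) (⟦ d ⟧ p) a k m →
    node (leaf ⟨ a , k ⟩) (node (program (precᶜ e d)) κ) ⟶ node (leaf m) κ

  -- `_≤‴_` counts up from the candidate `i`, as the search does.
  interpret-search : ∀ e {n i m} κ → i ≤‴ m → ⟦ e ⟧ p ⟨ n , m ⟩ 0 →
    (∀ i → i < m → ∃[ j ] ⟦ e ⟧ p ⟨ n , i ⟩ (suc j)) →
    node (leaf i) (node (try (program e) (leaf n)) κ) ⟶ node (leaf m) κ

  interpret zeroᶜ       κ refl = tick done
  interpret succᶜ       κ refl = tick done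
  interpret leftᶜ {m = m} κ (b , refl) =
    silent refl (cong (λ x → node (leaf (proj₁ x)) κ) (unpair-pair m b)) done
  interpret rightᶜ {m = m} κ (a , refl) =
    silent refl (cong (λ x → node (leaf (proj₂ x)) κ) (unpair-pair a m)) done
  interpret oracleᶜ     κ refl = tick done
  interpret (pairᶜ e d) κ (a , b , x , y , refl) =
    tick (interpret e _ x ◅ tick (interpret d _ y ◅ tick done))
  interpret (compᶜ e d) κ (k , x , y) = tick (interpret d _ x ◅ interpret e _ y)
  interpret (precᶜ e d) κ (a , k , refl , x) = interpret-prec e d a k κ x
  interpret (rfindᶜ e)  κ (x , y) = tick (interpret-search e κ (≤⇒≤‴ z≤n) x y)

  interpret-prec e d a zero    κ x =
    silent refl (step-prec-zero {⟨ a , 0 ⟩} e d κ (unpair-pair a 0)) (interpret e κ x)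
  interpret-prec e d a (suc k) κ (r , x , y) =
    silent refl (step-prec-suc {⟨ a , suc k ⟩} e d κ (unpair-pair a (suc k)))
      (interpret-prec e d a k _ x ◅ tick (interpret d κ y))

  interpret-search e κ ≤‴-refl       x y = tick (interpret e _ x ◅ tick done)
  interpret-search e {i = i} κ (≤‴-step i<m) x y =
    tick (interpret e _ (proj₂ (y i (≤‴⇒≤ i<m))) ◅ tick (interpret-search e κ i<m x y))

  launch : Tree → ℕ → Tree
  launch c i = evalTree p launchᵗ (node c (leaf i))

  argument : Code → ℕ → ℕ
  argument e i = ⟨ ⟨ encode (program e) , proj₁ (unpair i) ⟩ , proj₂ (unpair i) ⟩

  -- Induction on the prefix length with the start `i` free: emitting a letter relaunches the
  -- program at `suc i`, with `q` shifted.
  launch-lists : ∀ e (q : Baire) i → (∀ k → ⟦ e ⟧ p (argument e (k + i)) (q k)) →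
                 outputs (launch (program e) i) -1≐ q
  launch-lists e q i h zero    = 0 , refl
  launch-lists e q i h (suc k) =
    word-silent (interpret e _ (h 0))
      (word-emit refl refl
        (launch-lists e (λ k → q (suc k)) (suc i) (λ k → h′ k (h (suc k))) k))
    where
    h′ : ∀ k → ⟦ e ⟧ p (argument e (suc k + i)) (q (suc k)) →
               ⟦ e ⟧ p (argument e (k + suc i)) (q (suc k))
    h′ k = subst (λ j → ⟦ e ⟧ p (argument e j) (q (suc k))) (sym (+-suc k i))

  universal-lists : ∀ e (q : Baire) → (∀ k → ⟦ e ⟧ p (argument e k) (q k)) →
    (λ j → eval p universalᵗ ⟨ encode (program e) , j ⟩) -1≐ q
  universal-lists e q h =
    -1≐-respects {outputs (launch (program e) 0)} {q = q} outputs≗ (λ _ → refl)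
      (launch-lists e q 0 h′)
    where
    h′ : ∀ k → ⟦ e ⟧ p (argument e (k + 0)) (q k)
    h′ k = subst (λ j → ⟦ e ⟧ p (argument e j) (q k)) (sym (+-identityʳ k)) (h k)
    outputs≗ : ∀ j → outputs (launch (program e) 0) j ≡
                     eval p universalᵗ ⟨ encode (program e) , j ⟩
    outputs≗ = encode-orbit p outputᵗ launchᵗ stepᵗ (program e)

-- Dropping the zeros from one component

-- A search state ⟨ j , ⟨ c , l ⟩ ⟩: the next position to read in component i,
-- the number of letters of p - 1 still to be found, and the last letter found.
module LetterSearch (i : ℕ) (p : Baire) where

  seekᵗ : Term
  seekᵗ = (pairᵗ (succᵗ ∙ leftᵗ) rightᵗ
           ▹ pairᵗ (succᵗ ∙ leftᵗ ∙ rightᵗ) (pairᵗ (predᵗ ∙ leftᵗ ∙ rightᵗ ∙ rightᵗ) leftᵗ))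
          ∙ pairᵗ (oracleᵗ ∙ pairᵗ (constᵗ i) leftᵗ) (pairᵗ leftᵗ rightᵗ)
    where
    predᵗ = (constᵗ 0 ▹ leftᵗ) ∙ pairᵗ atomᵗ (constᵗ 0)

  beginᵗ missingᵗ lastᵗ : Term
  -- Letter `k` is reached once `suc k` letters have been read.
  beginᵗ   = pairᵗ (constᵗ 0) (pairᵗ succᵗ (constᵗ 0))
  missingᵗ = (leftᵗ ∙ rightᵗ) ∙ iterᵗ beginᵗ seekᵗ
  lastᵗ    = (rightᵗ ∙ rightᵗ) ∙ iterᵗ beginᵗ seekᵗ

  seek : Tree → Tree
  seek = evalTree p seekᵗ

  state : ℕ → ℕ → ℕ → Tree
  state j c l = node (leaf j) (node (leaf c) (leaf l))

  missing : Tree → ℕ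
  missing s = encode (leftTree (rightTree s))

  last : Tree → ℕ
  last s = encode (rightTree (rightTree s))

  seek-zero : ∀ j c l → component p i j ≡ 0 → seek (state j c l) ≡ state (suc j) c l
  seek-zero j c l eq rewrite eq = refl

  seek-suc : ∀ j c l a → component p i j ≡ suc a →
             seek (state j (suc c) l) ≡ state (suc j) c a
  seek-suc j c l a eq rewrite eq = refl

  -- The last condition makes `m` minimal, as `rfindᶜ` demands.
  FoundAt : Tree → ℕ → ℕ → Set
  FoundAt s a m = missing (iterate seek s m) ≡ 0 × last (iterate seek s m) ≡ a ×
                  (∀ k → k < m → ∃[ c ] missing (iterate seek s k) ≡ suc c)

  later : ∀ {s s′ a m c} → missing s ≡ suc c → seek s ≡ s′ →
          FoundAt s′ a m → FoundAt s a (suc m)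
  later {c = c} z refl (x , y , h) = x , y , λ where
    zero    _         → c , z
    (suc k) (s≤s k<m) → h k k<m

  -- `r` is the component from position `j` on, and `m` bounds the entries to inspect. A zero keeps
  -- the target `c`; a letter lowers it or, at 0, is the one sought.
  found : ∀ (r q : Baire) m j c l → (∀ k → component p i (k + j) ≡ r k) →
          word-1 r m ≡ applyUpTo q (suc c) → ∃[ m ] FoundAt (state j (suc c) l) (q c) m
  found r q zero    j c l eq ()
  found r q (suc m) j c l eq w with r 0 in r0
  ... | zero  =
    _ , later refl (seek-zero j (suc c) l (trans (eq 0) r0))
          (proj₂ (found (λ k → r (suc k)) q m (suc j) c l eq′ w))
    where
    eq′ : ∀ k → component p i (k + suc j) ≡ r (suc k)
    eq′ k = trans (cong (component p i) (+-suc k j)) (eq (suc k))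
  found r q (suc m) j zero l eq w | suc a =
    1 , later {m = 0} refl (seek-suc j 0 l a (trans (eq 0) r0))
          (refl , proj₁ (∷-injective w) , λ _ ())
  found r q (suc m) j (suc c) l eq w | suc a =
    _ , later refl (seek-suc j (suc c) l a (trans (eq 0) r0))
          (proj₂ (found (λ k → r (suc k)) (λ k → q (suc k)) m (suc j) c a eq′
                   (proj₂ (∷-injective w))))
    where
    eq′ : ∀ k → component p i (k + suc j) ≡ r (suc k)
    eq′ k = trans (cong (component p i) (+-suc k j)) (eq (suc k))

  missing-sound : ∀ k m {c} → missing (iterate seek (state 0 (suc k) 0) m) ≡ c →
                  ⟦ compile missingᵗ ⟧ p ⟨ k , m ⟩ c
  missing-sound k m h =
    subst (⟦ compile missingᵗ ⟧ p ⟨ k , m ⟩)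
          (trans (sym (encode-eval p missingᵗ (node (leaf k) (leaf m)))) h)
          (compile-sound p missingᵗ ⟨ k , m ⟩)

  last-sound : ∀ k m {l} → last (iterate seek (state 0 (suc k) 0) m) ≡ l →
               ⟦ compile lastᵗ ⟧ p ⟨ k , m ⟩ l
  last-sound k m h =
    subst (⟦ compile lastᵗ ⟧ p ⟨ k , m ⟩)
          (trans (sym (encode-eval p lastᵗ (node (leaf k) (leaf m)))) h)
          (compile-sound p lastᵗ ⟨ k , m ⟩)

  -1≐-component⇒≤T : ∀ {q} → component p i -1≐ q → q ≤T p
  -1≐-component⇒≤T {q} h =
    compᶜ (compile lastᵗ) (pairᶜ idᶜ (rfindᶜ (compile missingᵗ))) , λ k →
    let n , w             = h (suc k)
        m , x , y , below = found (component p i) q n 0 k 0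
                              (λ j → cong (component p i) (+-identityʳ j)) w
    in ⟨ k , m ⟩ ,
       (k , m , idᶜ-sound {p} k ,
        (missing-sound k m x ,
         λ j j<m → proj₁ (below j j<m) , missing-sound k j (proj₂ (below j j<m))) ,
        refl) ,
       last-sound k m y

open LetterSearch using (-1≐-component⇒≤T)

-- The two reductions

mergeᵗ : Term
mergeᵗ = oracleᵗ ∙ pairᵗ (leftᵗ ∙ leftᵗ) (pairᵗ (rightᵗ ∙ leftᵗ) rightᵗ)

stashing≤cone : ExcludedMiddle 0ℓ → ∀ {X Y} (f : Problem X Y) → Σ (Π f) ≤sW (Π f) ᴰ
stashing≤cone em {X} {Y} f =
  operator universalᵗ , operator mergeᵗ ,
  operator-computable universalᵗ , operator-computable mergeᵗ , realizes
  where
  module X = Setoid (points X)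
  module Y = Setoid (points Y)

  realizes : ∀ G → G Realizes multiMap ((Π f) ᴰ) →
             (operator universalᵗ ∘ₚ G ∘ₚ operator mergeᵗ) Realizes multiMap (Σ (Π f))
  realizes G G-realizes p x px (_ , d , _) =
    let g , _ , Gg , g≡ , q , q≡ , y , (y₀ , y₀-names , y₀≤q) , y∈f =
          G-realizes (eval p mergeᵗ) x′ x′-named
            (Equivalence.from (dom-cone (multiMap (Π f)) x′) x′∈dom)
        -- The code `e` depends on `g`, but `universalᵗ` does not: it serves every code, each in its
        -- own component.
        e , y₀-computed = ≤T-trans y₀≤q (≤T-trans (proj₁ q≡) (proj₂ g≡))
        n = encode (program e)
        r = eval g universalᵗ
        -- Components other than `n` may list anything; excluded middle still gives each a point,
        -- possibly `⊥`.
        ȳ = λ m → completion-total em (Y ^ℕ) (component r m)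
    in r , (λ m → proj₁ (ȳ m)) ,
       (g , (eval p mergeᵗ , (λ _ → refl) , Gg) , λ _ → refl) ,
       (λ m → proj₂ (ȳ m)) ,
       d , n , (λ i → y ⟨ n , i ⟩) ,
       -- At `n` that point must be the solution, since both have the same name.
       singleValued (δ (completion (Y ^ℕ))) {component r n} (proj₂ (ȳ n))
         (row y₀ n ,
          Machine.universal-lists g e (row y₀ n) (λ k → y₀-computed (Machine.argument g e k)) ,
          λ i → respects (δ Y) (component-row y₀ n i) Y.refl (y₀-names ⟨ n , i ⟩)) ,
       λ i → MultiMap.respects (multiMap f)
               (X.reflexive (cong (λ z → x (proj₁ z) (proj₂ z)) (unpair-pair n i)))
               Y.refl (y∈f ⟨ n , i ⟩)
    where
    x′ : ℕ → Point X
    x′ m = x (proj₁ (unpair m)) (proj₂ (unpair m))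

    x′-named : ∀ m → graph (δ X) (component (eval p mergeᵗ) m) (x′ m)
    x′-named m =
      respects (δ X) (λ k → encode-eval p mergeᵗ (node (leaf m) (leaf k))) X.refl
        (px (proj₁ (unpair m)) (proj₂ (unpair m)))

    x′∈dom : dom (multiMap (Π f)) x′
    x′∈dom = (λ m → proj₁ (d (proj₁ (unpair m))) (proj₂ (unpair m))) ,
             (λ m → proj₂ (d (proj₁ (unpair m))) (proj₂ (unpair m)))

    -- Regroups the components `⟨ n , i ⟩` into one name, in the order of `Machine.argument`.
    row : Baire → ℕ → Baire
    row s n k = s ⟨ ⟨ n , proj₁ (unpair k) ⟩ , proj₂ (unpair k) ⟩

    component-row : ∀ s n i → component s ⟨ n , i ⟩ ≗ component (row s n) i
    component-row s n i j =
      cong (λ z → s ⟨ ⟨ n , proj₁ z ⟩ , proj₂ z ⟩) (sym (unpair-pair i j))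

copyᵗ : Term
copyᵗ = oracleᵗ ∙ rightᵗ

cone≤stashing : ∀ {X Y} (g : Problem X Y) → g ᴰ ≤sW Σ g
cone≤stashing {X} {Y} g =
  -- The first operator is the identity: the whole answer represents the degree.
  operator oracleᵗ , operator copyᵗ ,
  operator-computable oracleᵗ , operator-computable copyᵗ , realizes
  where
  realizes : ∀ G → G Realizes multiMap (Σ g) →
             (operator oracleᵗ ∘ₚ G ∘ₚ operator copyᵗ) Realizes multiMap (g ᴰ)
  realizes G G-realizes p x px x∈dom =
    let r , ȳ , Gr , r-names , _ , n , y , ȳn≈y , y∈g =
          G-realizes (eval p copyᵗ) (λ _ → x) x-named
            (Equivalence.from (dom-stashing (multiMap g) (λ _ → x))
              (λ _ → Equivalence.to (dom-cone (multiMap g) x) x∈dom))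
        q , lists , q-names =
          respects (δ (completion Y)) {component r n} (λ _ → refl) ȳn≈y (r-names n)
    in r , r , (r , (eval p copyᵗ , (λ _ → refl) , Gr) , λ _ → refl) , 𝒟.refl ,
       r , 𝒟.refl , y , (q , q-names , -1≐-component⇒≤T n r lists) , y∈g
    where
    module 𝒟 = Setoid TuringDegree
    x-named : ∀ n → graph (δ X) (component (eval p copyᵗ) n) x
    x-named n = respects (δ X) (λ k → encode-eval p copyᵗ (node (leaf n) (leaf k)))
                  (Setoid.refl (points X)) px

proposition1p15 : ExcludedMiddle 0ℓ →
    ∀ (X Y : RepresentedSpace) (f : Problem X Y) → Σ (Π f) ≡sW (Π f) ᴰ
proposition1p15 em X Y f = stashing≤cone em f , cone≤stashing (Π f)
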